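{- For every sufficiently large positive integer $n$, there exists a pair of strings $S$ and $T$ such that $|ST| = n$ and $z(T)/z(ST) \in \Omega(\log n)$. That is, there exist constants $\kappa>0$ and $n_0$ such that for every integer $n\ge n_0$ there are strings $S,T$ with $|ST|=n$ and $z(T)\ge \kappa \log n\cdot z(ST)$.
   Context: The alphabet is not fixed: the strings may be over an alphabet depending on $n$. Strings are indexed from $0$: a string $S$ of length $n=|S|$ is $S[0]\cdots S[n-1]$, and $S[i..j]$ is the substring from position $i$ to position $j$. A factorization of $S$ is a sequence of nonempty strings (phrases) $F_1,\dots,F_m$ with $S=F_1\cdots F_m$; the starting position of $F_i$ is $b_i=\sum_{k=1}^{i-1}|F_k|$. The Lempel--Ziv (LZ) factorization of $S$ is built from left to right: if the character $S[b_i]$ has no occurrence in $S$ starting before $b_i$, then $F_i=S[b_i]$; otherwise $F_i$ is the longest prefix of $S[b_i..n-1]$ that has an occurrence in $S$ starting before $b_i$ (this earlier occurrence may overlap $F_i$). The number of phrases is denoted $z(S)$. -}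

module Defs where

open import Data.Empty using (⊥-elim)
open import Data.Fin.Base using (Fin)
import Data.Fin.Properties as Fin
open import Data.Integer.Base using (+_)
open import Data.List.Base using (List; []; _∷_; _++_; [_]; length; concat; drop; take)
open import Data.List.Properties
  using (take++drop≡id; drop-drop; length-take; length-drop; ++-cancelˡ)
open import Data.List.Relation.Binary.Prefix.Heterogeneous using (Prefix; []; _∷_)
open import Data.List.Relation.Binary.Prefix.Heterogeneous.Properties using (prefix?; length-mono)
open import Data.List.Relation.Unary.All using (All; []; _∷_)
open import Data.Nat.Base
open import Data.Nat.Properties
open import Data.Product.Base using (∃; _×_; _,_; proj₁; proj₂)
open import Data.Rational.Base using (ℚ) renaming (_/_ to _/ℚ_)
open import Data.Sum.Base using (inj₁; inj₂)
open import Data.Unit.Base using (⊤; tt)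
open import Relation.Binary.PropositionalEquality hiding ([_])
open import Relation.Nullary.Decidable using (Dec; yes; no)
open import Relation.Nullary.Negation using (¬_; contradiction)

Str : ℕ → Set
Str σ = List (Fin σ)

-- Positions count from 0.  `drop j S` is the suffix of S starting at j.
OccursAt : ∀ {σ} → Str σ → ℕ → Str σ → Set
OccursAt S j w = Prefix _≡_ w (drop j S)

-- Only the starting position is constrained: an occurrence starting before b
-- may extend past b.
OccursBefore : ∀ {σ} → Str σ → ℕ → Str σ → Set
OccursBefore S b w = ∃ λ j → j < b × OccursAt S j w

record IsLongestCopy {σ} (S : Str σ) (b : ℕ) (F : Str σ) : Set where
  constructor longestCopy
  field
    prefix  : Prefix _≡_ F (drop b S)
    earlier : OccursBefore S b F
    longest : ∀ G → Prefix _≡_ G (drop b S) → OccursBefore S b G → length G ≤ length F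

data IsLZPhrase {σ} (S : Str σ) (b : ℕ) : Str σ → Set where
  fresh : ∀ {c rest} → drop b S ≡ c ∷ rest → ¬ OccursBefore S b [ c ] →
          IsLZPhrase S b [ c ]
  copy  : ∀ {c rest F} → drop b S ≡ c ∷ rest → OccursBefore S b [ c ] →
          IsLongestCopy S b F → IsLZPhrase S b F

-- The list consists of consecutive LZ phrases of S, the first starting at b.
LZPhrasesFrom : ∀ {σ} → Str σ → ℕ → List (Str σ) → Set
LZPhrasesFrom S b []       = ⊤
LZPhrasesFrom S b (F ∷ Fs) = IsLZPhrase S b F × LZPhrasesFrom S (b + length F) Fs

IsFactorization : ∀ {σ} → Str σ → List (Str σ) → Set
IsFactorization S Fs = All (_≢ []) Fs × concat Fs ≡ S

IsLZFactorization : ∀ {σ} → Str σ → List (Str σ) → Set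
IsLZFactorization S Fs = IsFactorization S Fs × LZPhrasesFrom S 0 Fs

private
  prefix⇒≡take : ∀ {σ} {w S : Str σ} → Prefix _≡_ w S → w ≡ take (length w) S
  prefix⇒≡take []         = refl
  prefix⇒≡take (refl ∷ p) = cong (_ ∷_) (prefix⇒≡take p)

  take-prefix : ∀ {σ} k (S : Str σ) → Prefix _≡_ (take k S) S
  take-prefix zero    S       = []
  take-prefix (suc k) []      = []
  take-prefix (suc k) (x ∷ S) = refl ∷ take-prefix k S

  phrase-nonempty : ∀ {σ} {S : Str σ} {b F} → IsLZPhrase S b F → F ≢ []
  phrase-nonempty (fresh _ _) ()
  phrase-nonempty (copy {c} e o l) refl
    with () ← IsLongestCopy.longest l [ c ] (subst (Prefix _≡_ [ c ]) (sym e) (refl ∷ [])) o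

  phrase-prefix : ∀ {σ} {S : Str σ} {b F} → IsLZPhrase S b F → Prefix _≡_ F (drop b S)
  phrase-prefix (fresh {c} e _) = subst (Prefix _≡_ [ c ]) (sym e) (refl ∷ [])
  phrase-prefix (copy _ _ l)    = IsLongestCopy.prefix l

  phrase-split : ∀ {σ} {S : Str σ} {b F} → IsLZPhrase S b F →
                 F ++ drop (b + length F) S ≡ drop b S
  phrase-split {S = S} {b} {F} p = begin
    F ++ drop (b + length F) S
      ≡⟨ cong₂ _++_ (prefix⇒≡take (phrase-prefix p)) (sym (drop-drop b (length F) S)) ⟩
    take (length F) (drop b S) ++ drop (length F) (drop b S)
      ≡⟨ take++drop≡id (length F) (drop b S) ⟩
    drop b S ∎
    where open ≡-Reasoning

occursBefore? : ∀ {σ} (S : Str σ) b w → Dec (OccursBefore S b w)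
occursBefore? S b w = anyUpTo? (λ j → prefix? Fin._≟_ w (drop j S)) b

private
  greatest : {P : ℕ → Set} → (∀ k → Dec (P k)) → P 1 → ∀ m →
             ∃ λ l → l ≤ suc m × P l × (∀ k → k ≤ suc m → P k → k ≤ l)
  greatest P? p1 zero = 1 , ≤-refl , p1 , λ k k≤1 _ → k≤1
  greatest P? p1 (suc m) with P? (suc (suc m))
  ... | yes p = suc (suc m) , ≤-refl , p , λ k k≤ _ → k≤
  ... | no ¬p with l , l≤ , pl , max ← greatest P? p1 m =
    l , m≤n⇒m≤1+n l≤ , pl , λ k k≤ pk → max k (lower k k≤ pk) pk
    where
    lower : ∀ k → k ≤ suc (suc m) → _ → k ≤ suc m
    lower k k≤ pk with m≤n⇒m<n∨m≡n k≤
    ... | inj₁ (s≤s k≤′) = k≤′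
    ... | inj₂ refl      = contradiction pk ¬p

  nextPhrase : ∀ {σ} (S : Str σ) b {c rest} → drop b S ≡ c ∷ rest → ∃ (IsLZPhrase S b)
  nextPhrase S b {c} {rest} e with occursBefore? S b [ c ]
  ... | no  new = [ c ] , fresh e new
  ... | yes old
    with l , l≤ , occ , max ← greatest (λ k → occursBefore? S b (take k (c ∷ rest))) old (length rest)
    = take l (c ∷ rest) , copy e old (longestCopy
        (subst (Prefix _≡_ _) (sym e) (take-prefix l (c ∷ rest))) occ longest)
    where
    longest : ∀ G → Prefix _≡_ G (drop b S) → OccursBefore S b G →
              length G ≤ length (take l (c ∷ rest))
    longest G p o = subst (length G ≤_)
      (sym (trans (length-take l (c ∷ rest)) (m≤n⇒m⊓n≡m l≤)))
      (max (length G) (length-mono p′) (subst (OccursBefore S b) (prefix⇒≡take p′) o))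
      where p′ = subst (Prefix _≡_ G) e p

  buildFrom : ∀ {σ} (S : Str σ) fuel b → length (drop b S) ≤ fuel →
              ∃ λ Fs → IsFactorization (drop b S) Fs × LZPhrasesFrom S b Fs
  buildFrom S fuel b h with drop b S in e
  buildFrom S fuel b h | [] = [] , ([] , refl) , tt
  buildFrom S (suc fuel) b (s≤s h) | c ∷ rest
    with F , p ← nextPhrase S b e
    with buildFrom S fuel (b + length F) (≤-trans (shorter F p) h)
    where
    shorter : ∀ F → IsLZPhrase S b F → length (drop (b + length F) S) ≤ length rest
    shorter []      p = ⊥-elim (phrase-nonempty p refl)
    shorter (x ∷ F) p = begin
      length (drop (b + suc (length F)) S)     ≡⟨ cong length (drop-drop b (suc (length F)) S) ⟨
      length (drop (suc (length F)) (drop b S)) ≡⟨ cong (λ R → length (drop (suc (length F)) R)) e ⟩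
      length (drop (length F) rest)            ≡⟨ length-drop (length F) rest ⟩
      length rest ∸ length F                   ≤⟨ m∸n≤m (length rest) (length F) ⟩
      length rest                              ∎
      where open ≤-Reasoning
  ... | Fs , (ne , cat) , ps =
    F ∷ Fs , (phrase-nonempty p ∷ ne , trans (cong (F ++_) cat) (trans (phrase-split p) e)) , p , ps

lzFactorization : ∀ {σ} (S : Str σ) → ∃ (IsLZFactorization S)
lzFactorization S = buildFrom S (length S) 0 ≤-refl

private
  phrase-unique : ∀ {σ} {S : Str σ} {b F G} → IsLZPhrase S b F → IsLZPhrase S b G → F ≡ G
  phrase-unique (fresh e _) (fresh e′ _) with refl ← trans (sym e) e′ = refl
  phrase-unique (fresh e new) (copy e′ old _) with refl ← trans (sym e) e′ = contradiction old new
  phrase-unique (copy e old _) (fresh e′ new) with refl ← trans (sym e) e′ = contradiction old new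
  phrase-unique {S = S} {b} (copy _ _ (longestCopy p o m)) (copy _ _ (longestCopy p′ o′ m′)) =
    trans (prefix⇒≡take p)
      (trans (cong (λ k → take k (drop b S)) (≤-antisym (m′ _ p o) (m _ p′ o′)))
        (sym (prefix⇒≡take p′)))

  phrases-unique : ∀ {σ} {S : Str σ} {b} Fs Gs → concat Fs ≡ drop b S → concat Gs ≡ drop b S →
                   LZPhrasesFrom S b Fs → LZPhrasesFrom S b Gs → Fs ≡ Gs
  phrases-unique [] [] _ _ _ _ = refl
  phrases-unique [] (G ∷ Gs) c _ _ (q , _) = ⊥-elim (stuck q c)
    where
    stuck : ∀ {σ} {S : Str σ} {b F} → IsLZPhrase S b F → ¬ ([] ≡ drop b S)
    stuck (fresh e _)  c with () ← trans c e
    stuck (copy e _ _) c with () ← trans c e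
  phrases-unique (F ∷ Fs) [] c d p q = sym (phrases-unique [] (F ∷ Fs) d c q p)
  phrases-unique {S = S} {b} (F ∷ Fs) (G ∷ Gs) c d (p , ps) (q , qs) with refl ← phrase-unique p q =
    cong (F ∷_) (phrases-unique Fs Gs (rest c) (rest d) ps qs)
    where
    rest : ∀ {R} → F ++ R ≡ drop b S → R ≡ drop (b + length F) S
    rest h = ++-cancelˡ F _ _ (trans h (sym (phrase-split p)))

lzFactorization-unique : ∀ {σ} {S : Str σ} {Fs Gs} →
                         IsLZFactorization S Fs → IsLZFactorization S Gs → Fs ≡ Gs
lzFactorization-unique ((_ , c) , p) ((_ , d) , q) = phrases-unique _ _ c d p q

z : ∀ {σ} → Str σ → ℕ
z S = length (proj₁ (lzFactorization S))

z-unique : ∀ {σ} {S : Str σ} {Fs} → IsLZFactorization S Fs → z S ≡ length Fs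
z-unique {S = S} p = cong length (lzFactorization-unique (proj₂ (lzFactorization S)) p)

-- Real-valued quantities κ log n with κ > 0 are bounded through κ ⌈log₂ n⌉ with
-- κ rational: for n ≥ 2, log₂ n ≤ ⌈log₂ n⌉ ≤ 2 log₂ n, so up to the choice of κ
-- the two lower bounds are the same (and so is the base of the logarithm).
ℕ→ℚ : ℕ → ℚ
ℕ→ℚ n = (+ n) /ℚ 1

{-# OPTIONS --safe #-}

-- Switch p = 2 ^ k bits on one at a time, in bit-reversed order of their positions,
-- with a letter encoding a position and its bit.  Consecutive snapshots differ in
-- one letter, so the sequence S of all snapshots has O(p) phrases, and T, which
-- lists p - 1 of these snapshots once more, adds at most one phrase for each.
-- T visits the moments in the order of a bisection: when the middle of a time
-- interval is reached, all moments visited before lie outside the interval.  At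
-- depth l, the positions switched in its first and in its second half alternate
-- along the string with period 2 ^ (l + 1), so every window of that length contains
-- a position that is on now but off in the snapshots before the interval, and one
-- that is off now but on in those after it: the window has no earlier occurrence
-- in T.  Hence each of the k depths costs T at least p / 2 phrases, and log n = Θ(k).

module Submission where

open import Defs

module Construction where

  open import Data.Bool.Base using (Bool; true; false)
  open import Data.Fin.Base using (Fin; toℕ)
  open import Data.Fin.Properties using (toℕ-fromℕ<)
  open import Data.List.Base using (List; []; _∷_; _++_; [_]; length; concat; drop; map; replicate)
  open import Data.List.Properties
    using (drop-drop; length-drop; length-++; length-map; length-replicate; ++-assoc; ++-identityʳ; map-++; map-∘; concat-++)
  open import Data.List.Relation.Binary.Prefix.Heterogeneous using (Prefix; []; _∷_; _++ᵖ_)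
  open import Data.List.Relation.Binary.Prefix.Heterogeneous.Properties
    using (length-mono) renaming (trans to prefix-compose)
  open import Data.List.Relation.Unary.All as All using (All; []; _∷_)
  import Data.List.Relation.Unary.All.Properties as All
  open import Data.List.Relation.Unary.AllPairs as AllPairs using (AllPairs; []; _∷_)
  import Data.List.Relation.Unary.AllPairs.Properties as AllPairs
  open import Data.List.Relation.Unary.Any as Any using (Any; here; there)
  import Data.List.Relation.Unary.Any.Properties as Any
  open import Data.Nat.Base
  open import Data.Nat.DivMod using (_mod_; m%n<n; m<n⇒m%n≡m)
  open import Data.Nat.ListAction using (sum)
  open import Data.Nat.ListAction.Properties using (sum-++)
  open import Data.Nat.Logarithm using (⌈log₂_⌉; ⌈log₂⌉-mono-≤; ⌈log₂2^n⌉≡n)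
  open import Data.Nat.Properties
  open import Data.Nat.Solver using (module +-*-Solver)
  open import Data.Product.Base using (Σ; ∃; _×_; _,_; proj₁; proj₂)
  open import Data.Sum.Base as Sum using (_⊎_; inj₁; inj₂)
  open import Data.Unit.Base using (⊤; tt)
  open import Function.Base using (_∘_)
  open import Relation.Binary.PropositionalEquality hiding ([_])
  open import Relation.Nullary.Decidable using (yes; no; toWitness)
  open import Relation.Nullary.Negation using (¬_; contradiction)

  private variable
    A : Set
    σ b c m n : ℕ
    u v w : List A
    S U F G : Str σ
    Fs Gs : List (Str σ)

  -- Prefixes, suffixes and elementary facts on LZ phrases.

  prefix-drop : ∀ d → Prefix _≡_ u v → Prefix _≡_ (drop d u) (drop d v)
  prefix-drop zero    p       = p
  prefix-drop (suc d) []      = []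
  prefix-drop (suc d) (_ ∷ p) = prefix-drop d p

  prefix-within : Prefix _≡_ u w → Prefix _≡_ v w → length u ≤ length v → Prefix _≡_ u v
  prefix-within []      _       _       = []
  prefix-within (e ∷ p) (f ∷ q) (s≤s l) = trans e (sym f) ∷ prefix-within p q l

  prefix-++ : ∀ (u v : List A) → Prefix _≡_ u (u ++ v)
  prefix-++ []      v = []
  prefix-++ (x ∷ u) v = refl ∷ prefix-++ u v

  drop-length-++ : ∀ (u : List A) d v → drop (length u + d) (u ++ v) ≡ drop d v
  drop-length-++ []      d v = refl
  drop-length-++ (x ∷ u) d v = drop-length-++ u d v

  drop-++-exact : ∀ (u v : List A) → drop (length u) (u ++ v) ≡ v
  drop-++-exact []      v = refl
  drop-++-exact (x ∷ u) v = drop-++-exact u v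

  drop≡[]⇒length≤ : ∀ d (u : List A) → drop d u ≡ [] → length u ≤ d
  drop≡[]⇒length≤ zero    []      _ = z≤n
  drop≡[]⇒length≤ (suc d) []      _ = z≤n
  drop≡[]⇒length≤ (suc d) (x ∷ u) e = s≤s (drop≡[]⇒length≤ d u e)

  length≤⇒drop≡[] : ∀ d (u : List A) → length u ≤ d → drop d u ≡ []
  length≤⇒drop≡[] zero    []      _       = refl
  length≤⇒drop≡[] (suc d) []      _       = refl
  length≤⇒drop≡[] (suc d) (x ∷ u) (s≤s l) = length≤⇒drop≡[] d u l

  occursBefore-inside : ∀ d → OccursBefore S b F → Prefix _≡_ G (drop d F) → OccursBefore S (b + d) G
  occursBefore-inside {S = S} d (j , j<b , q) p =
    j + d , +-monoˡ-< d j<b ,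
    subst (Prefix _≡_ _) (drop-drop j d S) (prefix-compose trans p (prefix-drop d q))

  phrase-prefix : IsLZPhrase S b F → Prefix _≡_ F (drop b S)
  phrase-prefix (fresh e _)  = subst (Prefix _≡_ _) (sym e) (refl ∷ [])
  phrase-prefix (copy _ _ l) = IsLongestCopy.prefix l

  phrase-nonempty : IsLZPhrase S b F → 1 ≤ length F
  phrase-nonempty (fresh _ _)  = s≤s z≤n
  phrase-nonempty (copy e o l) =
    IsLongestCopy.longest l _ (subst (Prefix _≡_ _) (sym e) (refl ∷ [])) o

  phrase-earlier : IsLZPhrase S b F → length F ≡ 1 ⊎ OccursBefore S b F
  phrase-earlier (fresh _ _)  = inj₁ refl
  phrase-earlier (copy _ _ l) = inj₂ (IsLongestCopy.earlier l)

  -- A fresh phrase is maximal too: a nonempty `G` starts with the new letter, so an earlier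
  -- occurrence of `G` would contain an earlier one of that letter.
  phrase-longest : ∀ G → IsLZPhrase S b F → Prefix _≡_ G (drop b S) → OccursBefore S b G →
                   length G ≤ length F
  phrase-longest G       (copy _ _ l)  p o = IsLongestCopy.longest l G p o
  phrase-longest []      (fresh _ _)   p o = z≤n
  phrase-longest {S = S} {b} (g ∷ G) (fresh e new) p (j , j<b , q)
    with drop b S | drop j S in eq
  phrase-longest {S = S} {b} (g ∷ G) (fresh refl new) (refl ∷ p) (j , j<b , refl ∷ q) | _ | _ =
    contradiction (j , j<b , subst (Prefix _≡_ _) (sym eq) (refl ∷ [])) new

  concat-tail : ∀ (S : Str σ) b F Fs → concat (F ∷ Fs) ≡ drop b S → concat Fs ≡ drop (b + length F) S
  concat-tail S b F Fs e = begin
    concat Fs                           ≡⟨ drop-++-exact F (concat Fs) ⟨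
    drop (length F) (F ++ concat Fs)    ≡⟨ cong (drop (length F)) e ⟩
    drop (length F) (drop b S)          ≡⟨ drop-drop b (length F) S ⟩
    drop (b + length F) S               ∎
    where open ≡-Reasoning

  -- Lower bounds on z from consecutive novel windows.

  -- Length at least 2 keeps a window from fitting inside a single fresh letter.
  NovelWindow : Str σ → ℕ → Str σ → Set
  NovelWindow S c G = 2 ≤ length G × Prefix _≡_ G (drop c S) × ¬ OccursBefore S c G

  NovelFrom : Str σ → ℕ → List (Str σ) → Set
  NovelFrom S c []       = ⊤
  NovelFrom S c (G ∷ Gs) = NovelWindow S c G × NovelFrom S (c + length G) Gs

  -- Otherwise `G` lies inside `F` at offset `d`. `F` then has more than one letter, so it is a
  -- copy, and its source shifted by `d` is an earlier occurrence of `G`.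
  phrase-ends-before-window : IsLZPhrase S b F → b ≤ c → NovelWindow S c G →
                              b + length F < c + length G
  phrase-ends-before-window {S = S} {b = b} {F = F} {G = G} φ b≤c (2≤G , p , new)
    with d , refl ← m≤n⇒∃[o]m+o≡n b≤c = ≰⇒> λ h → new (occ h (phrase-earlier φ))
    where
    occ : b + d + length G ≤ b + length F → length F ≡ 1 ⊎ OccursBefore S b F →
          OccursBefore S (b + d) G
    occ h (inj₁ one) = contradiction (≤-trans 2≤G (≤-trans (m≤n+m (length G) d) le)) λ { (s≤s ()) }
      where
      le : d + length G ≤ 1
      le = subst (d + length G ≤_) one
        (+-cancelˡ-≤ b _ _ (subst (_≤ b + length F) (+-assoc b d (length G)) h))
    occ h (inj₂ o) = occursBefore-inside d o
      (prefix-within (subst (Prefix _≡_ G) (sym (drop-drop b d S)) p)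
        (prefix-drop d (phrase-prefix φ)) fits)
      where
      open ≤-Reasoning
      fits : length G ≤ length (drop d F)
      fits = begin
        length G             ≤⟨ m+n≤o⇒m≤o∸n (length G) (subst (_≤ length F) (+-comm d _) (+-cancelˡ-≤ b _ _ (subst (_≤ b + length F) (+-assoc b d (length G)) h))) ⟩
        length F ∸ d         ≡⟨ length-drop d F ⟨
        length (drop d F)    ∎

  -- Both lists are scanned with the phrase boundary `b` never ahead of the window start `c`. A
  -- phrase ending by `c` is skipped; any other one ends before the window does, so it is charged to
  -- that window and the invariant survives.
  novel≤phrases : ∀ Gs Fs → b ≤ c → NovelFrom S c Gs → LZPhrasesFrom S b Fs →
                  concat Fs ≡ drop b S → length Gs ≤ length Fs
  novel≤phrases [] Fs _ _ _ _ = z≤n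
  novel≤phrases {b} {c} {S = S} (G ∷ Gs) [] b≤c ((2≤G , p , _) , _) _ e =
    contradiction (≤-trans 2≤G (length-mono p))
      (subst (λ R → ¬ 2 ≤ length R)
        (sym (length≤⇒drop≡[] c S (≤-trans (drop≡[]⇒length≤ b S (sym e)) b≤c))) λ ())
  novel≤phrases {b} {c} {S = S} (G ∷ Gs) (F ∷ Fs) b≤c (g , gs) (φ , φs) e with b + length F ≤? c
  ... | yes h = m≤n⇒m≤1+n (novel≤phrases (G ∷ Gs) Fs h (g , gs) φs (concat-tail S b F Fs e))
  ... | no  _ = s≤s (novel≤phrases Gs Fs (<⇒≤ (phrase-ends-before-window φ b≤c g)) gs φs (concat-tail S b F Fs e))

  novel≤z : NovelFrom S 0 Gs → length Gs ≤ z S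
  novel≤z {S = S} {Gs} gs with Fs , (_ , e) , φs ← lzFactorization S = novel≤phrases Gs Fs z≤n gs φs e

  -- Optimality of the greedy factorization.

  -- Any left-to-right parsing into single letters and (possibly overlapping)
  -- copies, with the number of its pieces.
  data Parse {σ} : Str σ → ℕ → Set where
    start  : Parse [] 0
    letter : Parse U m → ∀ x → Parse (U ++ [ x ]) (suc m)
    paste  : Parse U m → ∀ G → OccursBefore (U ++ G) (length U) G → Parse (U ++ G) (suc m)

  -- Some LZ phrase boundary b ≥ a is preceded by at most m phrases.
  record Passed {σ} (S : Str σ) (a m : ℕ) : Set where
    constructor passed
    field
      {boundary} : ℕ
      rest       : List (Str σ)
      beyond     : a ≤ boundary
      phrases    : LZPhrasesFrom S boundary rest
      covers     : concat rest ≡ drop boundary S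
      count      : z S ≤ m + length rest

  -- If the boundary `b` has not passed the piece, the next phrase starts inside it. What remains of
  -- `G` from there still has an earlier occurrence, so maximality carries that phrase to the end of
  -- the piece; one phrase per piece suffices.
  passed-piece : ∀ G → (length G ≤ 1 ⊎ OccursBefore S n G) → Prefix _≡_ G (drop n S) →
                 Passed S n m → Passed S (n + length G) (suc m)
  passed-piece {S = S} {n} {m} G g p (passed {b} Fs n≤b φs e h) with n + length G ≤? b
  ... | yes l = passed Fs l φs e (m≤n⇒m≤1+n h)
  -- With no phrase left, `b` is at or past the end of `S`, hence past the piece.
  passed-piece {S = S} {n} {m} G g p (passed {b} [] n≤b φs e h) | no ¬l = contradiction (begin
      n + length G             ≤⟨ +-monoʳ-≤ n (length-mono p) ⟩
      n + length (drop n S)    ≡⟨ cong (n +_) (length-drop n S) ⟩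
      n + (length S ∸ n)       ≤⟨ covered (drop≡[]⇒length≤ b S (sym e)) ⟩
      b                        ∎) ¬l
    where
    open ≤-Reasoning
    covered : length S ≤ b → n + (length S ∸ n) ≤ b
    covered l = ≤-trans (+-monoʳ-≤ n (∸-monoˡ-≤ n l)) (≤-reflexive (m+[n∸m]≡n n≤b))
  passed-piece {S = S} {n} {m} G g p (passed {b} (F ∷ Fs) n≤b (φ , φs) e h) | no ¬l =
    passed Fs (reach g) φs (concat-tail S b F Fs e) (≤-trans h (≤-reflexive (+-suc m (length Fs))))
    where
    open ≤-Reasoning
    reach : length G ≤ 1 ⊎ OccursBefore S n G → n + length G ≤ b + length F
    reach (inj₁ short) = ≤-trans (+-mono-≤ n≤b short) (+-monoʳ-≤ b (phrase-nonempty φ))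
    reach (inj₂ o) with d , refl ← m≤n⇒∃[o]m+o≡n n≤b = begin
      n + length G               ≤⟨ +-monoʳ-≤ n (m≤n+m∸n (length G) d) ⟩
      n + (d + (length G ∸ d))   ≡⟨ +-assoc n d _ ⟨
      n + d + (length G ∸ d)     ≡⟨ cong (n + d +_) (length-drop d G) ⟨
      n + d + length (drop d G)  ≤⟨ +-monoʳ-≤ (n + d) (phrase-longest (drop d G) φ
                                      (subst (Prefix _≡_ _) (drop-drop n d S) (prefix-drop d p))
                                      (occursBefore-inside d o (subst (Prefix _≡_ _) (++-identityʳ _) (prefix-++ (drop d G) [])))) ⟩
      n + d + length F           ∎

  occursBefore-extend : ∀ (R : Str σ) → OccursBefore S b G → OccursBefore (S ++ R) b G
  occursBefore-extend R (j , j<b , q) = j , j<b , go j _ q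
    where
    go : ∀ j (u : Str _) → Prefix _≡_ v (drop j u) → Prefix _≡_ v (drop j (u ++ R))
    go zero    u       q  = q ++ᵖ R
    go (suc j) []      [] = []
    go (suc j) (x ∷ u) q  = go j u q

  passed-++ : ∀ U G R → (length G ≤ 1 ⊎ OccursBefore (U ++ G) (length U) G) → S ≡ (U ++ G) ++ R →
              Passed S (length U) m → Passed S (length (U ++ G)) (suc m)
  passed-++ {m = m} U G R g refl h =
    subst (λ n → Passed ((U ++ G) ++ R) n (suc m)) (sym (length-++ U))
      (passed-piece G (Sum.map₂ (occursBefore-extend R) g) here-G h)
    where
    here-G : Prefix _≡_ G (drop (length U) ((U ++ G) ++ R))
    here-G = subst (Prefix _≡_ G)
      (sym (trans (cong (drop (length U)) (++-assoc U G R)) (drop-++-exact U (G ++ R)))) (prefix-++ G R)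

  parse-passed : ∀ R → Parse U m → S ≡ U ++ R → Passed S (length U) m
  parse-passed {S = S} R start e with Fs , (_ , f) , φs ← lzFactorization S in eq =
    passed Fs z≤n φs f (≤-reflexive (cong (λ x → length (proj₁ x)) eq))
  parse-passed R (letter {U = U} ps x) e =
    passed-++ U [ x ] R (inj₁ (s≤s z≤n)) e (parse-passed (x ∷ R) ps (trans e (++-assoc U _ R)))
  parse-passed R (paste {U = U} ps G o) e =
    passed-++ U G R (inj₂ o) e (parse-passed (G ++ R) ps (trans e (++-assoc U G R)))

  -- Once the boundary has passed all of `U`, no nonempty phrase can remain.
  z≤pieces : Parse U m → z U ≤ m
  z≤pieces {U = U} {m} ps with parse-passed [] ps (sym (++-identityʳ U))
  ... | passed []       _ _       _ h = subst (z U ≤_) (+-identityʳ m) h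
  ... | passed {b} (F ∷ Fs) l (φ , _) _ _ =
    contradiction (≤-trans (phrase-nonempty φ) (length-mono (phrase-prefix φ)))
      (subst (λ R → ¬ 1 ≤ length R) (sym (length≤⇒drop≡[] b U l)) λ ())

  -- Interleaving of bit sequences.

  infixr 6 _⋈_

  -- `f` fills the even positions and `g` the odd ones. Recursing through this puts the lowest
  -- binary digit of a position at the top level, which is the source of the bit-reversed order.
  _⋈_ : (f g : ℕ → Bool) → ℕ → Bool
  (f ⋈ g) zero          = f 0
  (f ⋈ g) (suc zero)    = g 0
  (f ⋈ g) (suc (suc x)) = ((f ∘ suc) ⋈ (g ∘ suc)) x

  ⋈-even : ∀ f g y → (f ⋈ g) (2 * y) ≡ f y
  ⋈-even f g zero = refl
  ⋈-even f g (suc y) rewrite +-suc y (y + 0) = ⋈-even (f ∘ suc) (g ∘ suc) y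

  ⋈-odd : ∀ f g y → (f ⋈ g) (suc (2 * y)) ≡ g y
  ⋈-odd f g zero = refl
  ⋈-odd f g (suc y) rewrite +-suc y (y + 0) = ⋈-odd (f ∘ suc) (g ∘ suc) y

  data Halved : ℕ → Set where
    even : ∀ y → Halved (2 * y)
    odd  : ∀ y → Halved (suc (2 * y))

  halve : ∀ x → Halved x
  halve zero = even 0
  halve (suc x) with halve x
  ... | even y = odd y
  ... | odd y  = subst Halved (*-suc 2 y) (even (suc y))

  ⋈-ext : ∀ {f g} h → (∀ y → h (2 * y) ≡ f y) → (∀ y → h (suc (2 * y)) ≡ g y) → h ≗ f ⋈ g
  ⋈-ext {f} {g} h e o x with halve x
  ... | even y = trans (e y) (sym (⋈-even f g y))
  ... | odd y  = trans (o y) (sym (⋈-odd f g y))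

  ⋈-cong : ∀ {f f′ g g′} → f ≗ f′ → g ≗ g′ → f ⋈ g ≗ f′ ⋈ g′
  ⋈-cong {f} {g = g} p q = ⋈-ext (f ⋈ g) (λ y → trans (⋈-even f g y) (p y)) (λ y → trans (⋈-odd f g y) (q y))

  zeros ones : ℕ → Bool
  zeros _ = false
  ones  _ = true

  -- Windows of positions and the bisection order.

  Hits : (ℕ → Set) → ℕ → ℕ → Set
  Hits P o l = ∃ λ x → o ≤ x × x < o + l × P x

  private
    window-double : ∀ m l → 2 * (m * l) ≡ m * (2 * l)
    window-double m l = trans (sym (*-assoc 2 m l)) (trans (cong (_* l) (*-comm 2 m)) (*-assoc m 2 l))

    window-start : ∀ m l {y} → m * l ≤ y → m * (2 * l) ≤ 2 * y
    window-start m l {y} h = subst (_≤ 2 * y) (window-double m l) (*-monoʳ-≤ 2 h)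

    window-end : ∀ m l {y} → y < m * l + l → suc (2 * y) < m * (2 * l) + 2 * l
    window-end m l {y} h = subst₂ _≤_ (*-suc 2 y)
      (trans (*-distribˡ-+ 2 (m * l) l) (cong (_+ 2 * l) (window-double m l))) (*-monoʳ-≤ 2 h)

  -- Doubling positions maps the `m`-th window of length `l` into the `m`-th window of length
  -- `2 * l`; `hits-odd` is the same for the odd places.
  hits-even : ∀ {P} m l → Hits (λ y → P (2 * y)) (m * l) l → Hits P (m * (2 * l)) (2 * l)
  hits-even m l (y , lo , hi , p) = 2 * y , window-start m l lo , <-trans (n<1+n _) (window-end m l hi) , p

  hits-odd : ∀ {P} m l → Hits (λ y → P (suc (2 * y))) (m * l) l → Hits P (m * (2 * l)) (2 * l)
  hits-odd m l (y , lo , hi , p) = suc (2 * y) , m≤n⇒m≤1+n (window-start m l lo) , window-end m l hi , p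

  -- The positions are cut into `blocks` windows of length `size`.
  record Shot : Set where
    constructor shot
    field
      blocks size : ℕ
      bits        : ℕ → Bool

  open Shot

  Window : Shot → (ℕ → Set) → Set
  Window s P = ∀ m → Hits P (m * size s) (size s)

  -- `g` plays an older snapshot: one difference in every window of `s` excludes copying any of
  -- these windows from `g`.
  Fresh : (ℕ → Bool) → Shot → Set
  Fresh g s = Window s λ x → g x ≢ bits s x

  Mixed : Shot → Set
  Mixed s = ∀ b → Window s λ x → bits s x ≡ b

  -- A moment of the tour on half as many positions is placed in the first half, where the odd
  -- positions are still off, or in the second, where the even ones are already on. Positions and
  -- window length both double, so the number of windows stays.
  earlyHalf lateHalf : Shot → Shot
  earlyHalf s = shot (blocks s) (2 * size s) (bits s ⋈ zeros)
  lateHalf  s = shot (blocks s) (2 * size s) (ones ⋈ bits s)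

  middle : ℕ → Shot
  middle k = shot (2 ^ k) 2 (ones ⋈ zeros)

  -- The moments of the tour below, in the preorder of the binary search tree on
  -- its 2 ^ k - 1 interior moments.
  bisection : ℕ → List Shot
  bisection zero    = []
  bisection (suc k) = middle k ∷ map earlyHalf (bisection k) ++ map lateHalf (bisection k)

  hits-map : ∀ {P Q : ℕ → Set} {o l} → (∀ x → P x → Q x) → Hits P o l → Hits Q o l
  hits-map f (x , lo , hi , p) = x , lo , hi , f x p

  mixed-early : ∀ {s} → Mixed s → Mixed (earlyHalf s)
  mixed-early {s} mx b m = hits-even m (size s) (hits-map (λ y → trans (⋈-even (bits s) zeros y)) (mx b m))

  mixed-late : ∀ {s} → Mixed s → Mixed (lateHalf s)
  mixed-late {s} mx b m = hits-odd m (size s) (hits-map (λ y → trans (⋈-odd ones (bits s) y)) (mx b m))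

  mixed-middle : ∀ k → Mixed (middle k)
  -- A window of length 1 contains its own start `m`; doubling it gives one even position, on, and
  -- one odd position, off.
  mixed-middle k b m with one ← (m , ≤-reflexive (*-identityʳ m) , ≤-reflexive (trans (sym (+-comm m 1)) (cong (_+ 1) (sym (*-identityʳ m)))) , tt) | b
  ... | true  = hits-even m 1 (hits-map (λ y _ → ⋈-even ones zeros y) one)
  ... | false = hits-odd m 1 (hits-map (λ y _ → ⋈-odd ones zeros y) one)

  bisection-mixed : ∀ k → All Mixed (bisection k)
  bisection-mixed zero    = []
  bisection-mixed (suc k) = mixed-middle k ∷
    All.++⁺ (All.map⁺ (All.map (λ {s} → mixed-early {s}) (bisection-mixed k))) (All.map⁺ (All.map (λ {s} → mixed-late {s}) (bisection-mixed k)))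

  ≢-transport : ∀ {A : Set} {a a′ b b′ : A} → a′ ≡ a → b′ ≡ b → a ≢ b → a′ ≢ b′
  ≢-transport refl refl n = n

  true≢false : true ≢ false
  true≢false ()

  fresh-early : ∀ {g s} → Fresh g s → Fresh (g ⋈ zeros) (earlyHalf s)
  fresh-early {g} {s} f m = hits-even m (size s)
    (hits-map (λ y → ≢-transport (⋈-even g zeros y) (⋈-even (bits s) zeros y)) (f m))

  fresh-late : ∀ {g s} → Fresh g s → Fresh (ones ⋈ g) (lateHalf s)
  fresh-late {g} {s} f m = hits-odd m (size s)
    (hits-map (λ y → ≢-transport (⋈-odd ones g y) (⋈-odd ones (bits s) y)) (f m))

  -- The middle has every even position on, while each window of an early moment keeps an even
  -- position off.
  middle-fresh-early : ∀ {k s} → Mixed s → Fresh (bits (middle k)) (earlyHalf s)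
  middle-fresh-early {s = s} mx m = hits-even m (size s)
    (hits-map (λ y h → ≢-transport (⋈-even ones zeros y) (trans (⋈-even (bits s) zeros y) h) true≢false) (mx false m))

  -- Up to the middle all odd positions are off, while each window of a late moment has an odd
  -- position on. This serves the middle (`g = ones`) and all early moments alike.
  even-fresh-late : ∀ {g s} → Mixed s → Fresh (g ⋈ zeros) (lateHalf s)
  even-fresh-late {g} {s} mx m = hits-odd m (size s)
    (hits-map (λ y h → ≢-transport (⋈-odd g zeros y) (trans (⋈-odd ones (bits s) y) h) (true≢false ∘ sym)) (mx true m))

  bisection-fresh : ∀ k → AllPairs (λ s t → Fresh (bits s) t) (bisection k)
  bisection-fresh zero    = []
  bisection-fresh (suc k) =
    All.++⁺ (All.map⁺ (All.map (λ {s} → middle-fresh-early {k} {s}) mx)) (All.map⁺ (All.map (λ {s} → even-fresh-late {ones} {s}) mx)) ∷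
    AllPairs.++⁺
      (AllPairs.map⁺ (AllPairs.map (λ {s} {t} → fresh-early {bits s} {t}) (bisection-fresh k)))
      (AllPairs.map⁺ (AllPairs.map (λ {s} {t} → fresh-late {bits s} {t}) (bisection-fresh k)))
      (All.map⁺ (All.universal (λ s → All.map⁺ (All.map (λ {t} → even-fresh-late {bits s} {t}) mx)) (bisection k)))
    where mx = bisection-mixed k

  Fits : ℕ → Shot → Set
  Fits p s = 2 ≤ size s × blocks s * size s ≡ p

  fits-double : ∀ {p s} → Fits p s → 2 ≤ 2 * size s × blocks s * (2 * size s) ≡ 2 * p
  fits-double {s = s} (h , e) =
    ≤-trans h (m≤n*m (size s) 2) , trans (sym (window-double (blocks s) (size s))) (cong (2 *_) e)

  bisection-fits : ∀ k → All (Fits (2 ^ k)) (bisection k)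
  bisection-fits zero    = []
  bisection-fits (suc k) = (≤-refl , *-comm (2 ^ k) 2) ∷
    All.++⁺ (All.map⁺ (All.map (λ {s} → fits-double {s = s}) (bisection-fits k))) (All.map⁺ (All.map (λ {s} → fits-double {s = s}) (bisection-fits k)))

  length-bisection : ∀ k → suc (length (bisection k)) ≡ 2 ^ k
  length-bisection zero    = refl
  length-bisection (suc k) = begin
    suc (suc (length (map earlyHalf s ++ map lateHalf s)))
      ≡⟨ cong (suc ∘ suc) (trans (length-++ (map earlyHalf s)) (cong₂ _+_ (length-map _ s) (length-map _ s))) ⟩
    suc (suc (length s + length s))
      ≡⟨ cong suc (+-suc (length s) (length s)) ⟨
    suc (length s) + suc (length s)
      ≡⟨ cong₂ _+_ (length-bisection k) (trans (length-bisection k) (sym (+-identityʳ _))) ⟩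
    2 ^ suc k ∎
    where
    open ≡-Reasoning
    s = bisection k

  totalBlocks : List Shot → ℕ
  totalBlocks ss = sum (map blocks ss)

  -- Depth l holds 2 ^ l shots of 2 ^ (k - 1 - l) windows each, so every one of the k depths
  -- contributes 2 ^ (k - 1). The factor 2 avoids the subtraction.
  totalBlocks-bisection : ∀ k → 2 * totalBlocks (bisection k) ≡ k * 2 ^ k
  totalBlocks-bisection zero    = refl
  totalBlocks-bisection (suc k) = begin
    2 * (2 ^ k + sum (map blocks (map earlyHalf s ++ map lateHalf s)))
      ≡⟨ cong (λ t → 2 * (2 ^ k + t)) halves ⟩
    2 * (2 ^ k + (totalBlocks s + totalBlocks s))
      ≡⟨ cong (λ t → 2 * (2 ^ k + (totalBlocks s + t))) (+-identityʳ (totalBlocks s)) ⟨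
    2 * (2 ^ k + 2 * totalBlocks s)
      ≡⟨ cong (λ t → 2 * (2 ^ k + t)) (totalBlocks-bisection k) ⟩
    2 * (suc k * 2 ^ k)
      ≡⟨ window-double (suc k) (2 ^ k) ⟩
    suc k * 2 ^ suc k ∎
    where
    open ≡-Reasoning
    s = bisection k
    halves : sum (map blocks (map earlyHalf s ++ map lateHalf s)) ≡ totalBlocks s + totalBlocks s
    halves = begin
      sum (map blocks (map earlyHalf s ++ map lateHalf s))
        ≡⟨ cong sum (map-++ blocks (map earlyHalf s) (map lateHalf s)) ⟩
      sum (map blocks (map earlyHalf s) ++ map blocks (map lateHalf s))
        ≡⟨ cong sum (cong₂ _++_ (map-∘ s) (map-∘ s)) ⟨
      sum (map blocks s ++ map blocks s)
        ≡⟨ sum-++ (map blocks s) (map blocks s) ⟩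
      totalBlocks s + totalBlocks s ∎

  -- Paths of snapshots and the bit-reversed tour.

  OneOff : ℕ → (f g : ℕ → Bool) → Set
  OneOff p f g = ∃ λ x → x < p × (∀ y → y < p → y ≢ x → f y ≡ g y)

  -- The list leaves out the start `f`. The end is matched only pointwise, since functions such as
  -- `zeros` and `zeros ⋈ zeros` agree at every position without being definitionally equal.
  data Path (p : ℕ) : (f g : ℕ → Bool) → List (ℕ → Bool) → Set where
    stop : ∀ {f g} → f ≗ g → Path p f g []
    step : ∀ {f g h hs} → OneOff p f h → Path p h g hs → Path p f g (h ∷ hs)

  path-start : ∀ {p f f′ g hs} → f ≗ f′ → Path p f′ g hs → Path p f g hs
  path-start e (stop e′)            = stop λ x → trans (e x) (e′ x)
  path-start e (step (x , l , d) π) = step (x , l , λ y l n → trans (e y) (d y l n)) π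

  path-end : ∀ {p f g g′ hs} → g ≗ g′ → Path p f g hs → Path p f g′ hs
  path-end e (stop e′)  = stop λ x → trans (e′ x) (e x)
  path-end e (step d π) = step d (path-end e π)

  path-++ : ∀ {p f g h is js} → Path p f g is → Path p g h js → Path p f h (is ++ js)
  path-++ (stop e)   π = path-start e π
  path-++ (step d ρ) π = step d (path-++ ρ π)

  oneOff-even : ∀ {p f g} h → OneOff p f g → OneOff (2 * p) (f ⋈ h) (g ⋈ h)
  oneOff-even {p} {f} {g} h (x , x<p , d) = 2 * x , *-monoʳ-< 2 x<p , same
    where
    same : ∀ y → y < 2 * p → y ≢ 2 * x → (f ⋈ h) y ≡ (g ⋈ h) y
    same y l n with halve y
    ... | even i = trans (⋈-even f h i) (trans (d i (*-cancelˡ-< 2 i p l) λ e → n (cong (2 *_) e)) (sym (⋈-even g h i)))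
    ... | odd i  = trans (⋈-odd f h i) (sym (⋈-odd g h i))

  oneOff-odd : ∀ {p f g} h → OneOff p f g → OneOff (2 * p) (h ⋈ f) (h ⋈ g)
  oneOff-odd {p} {f} {g} h (x , x<p , d) = suc (2 * x) , subst (_≤ 2 * p) (*-suc 2 x) (*-monoʳ-≤ 2 x<p) , same
    where
    same : ∀ y → y < 2 * p → y ≢ suc (2 * x) → (h ⋈ f) y ≡ (h ⋈ g) y
    same y l n with halve y
    ... | even i = trans (⋈-even h f i) (sym (⋈-even h g i))
    ... | odd i  = trans (⋈-odd h f i) (trans (d i (*-cancelˡ-< 2 i p (<-trans (n<1+n _) l)) λ e → n (cong (suc ∘ (2 *_)) e)) (sym (⋈-odd h g i)))

  path-map : ∀ {p q f g hs} (φ : (ℕ → Bool) → ℕ → Bool) →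
             (∀ {f g} → f ≗ g → φ f ≗ φ g) → (∀ {f g} → OneOff p f g → OneOff q (φ f) (φ g)) →
             Path p f g hs → Path q (φ f) (φ g) (map φ hs)
  path-map φ c o (stop e)   = stop (c e)
  path-map φ c o (step d π) = step (o d) (path-map φ c o π)

  -- All positions are switched on one at a time, in bit-reversed order.
  tour : ℕ → List (ℕ → Bool)
  tour zero    = ones ∷ []
  tour (suc k) = map (_⋈ zeros) (tour k) ++ map (ones ⋈_) (tour k)

  -- The halves meet at `ones ⋈ zeros`: the first leads there from `zeros ⋈ zeros`, the second
  -- continues to `ones ⋈ ones`.
  tour-path : ∀ k → Path (2 ^ k) zeros ones (tour k)
  tour-path zero    = step (0 , s≤s z≤n , λ { zero _ n → contradiction refl n ; (suc _) (s≤s ()) _ }) (stop λ _ → refl)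
  tour-path (suc k) = path-start (⋈-ext zeros (λ _ → refl) (λ _ → refl))
    (path-end (λ x → sym (⋈-ext ones (λ _ → refl) (λ _ → refl) x))
      (path-++
        (path-map (_⋈ zeros) (λ e → ⋈-cong e (λ _ → refl)) (oneOff-even zeros) (tour-path k))
        (path-map (ones ⋈_) (⋈-cong (λ _ → refl)) (oneOff-odd ones) (tour-path k))))

  length-tour : ∀ k → length (tour k) ≡ 2 ^ k
  length-tour zero    = refl
  length-tour (suc k) = trans (length-++ (map (_⋈ zeros) (tour k)))
    (cong₂ _+_ (trans (length-map _ (tour k)) (length-tour k))
      (trans (length-map _ (tour k)) (trans (length-tour k) (sym (+-identityʳ _)))))

  -- Needed for the middle moment `ones ⋈ zeros`, the image of `ones` in the first half of the next
  -- tour.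
  ones-visited : ∀ k → Any (ones ≗_) (tour k)
  ones-visited zero    = here λ _ → refl
  ones-visited (suc k) = Any.++⁺ʳ (map (_⋈ zeros) (tour k)) (Any.map⁺ (Any.map
    (λ e x → trans (⋈-ext ones (λ _ → refl) (λ _ → refl) x) (⋈-cong (λ _ → refl) e x)) (ones-visited k)))

  bisection-visited : ∀ k → All (λ s → Any (bits s ≗_) (tour k)) (bisection k)
  bisection-visited zero    = []
  bisection-visited (suc k) =
    Any.++⁺ˡ (Any.map⁺ (Any.map (λ e → ⋈-cong e λ _ → refl) (ones-visited k))) ∷
    All.++⁺
      (All.map⁺ (All.map (λ v → Any.++⁺ˡ (Any.map⁺ (Any.map (λ e → ⋈-cong e λ _ → refl) v))) (bisection-visited k)))
      (All.map⁺ (All.map (λ v → Any.++⁺ʳ (map (_⋈ zeros) (tour k)) (Any.map⁺ (Any.map (⋈-cong λ _ → refl) v))) (bisection-visited k)))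

  -- Snapshots as strings.

  -- Snapshots spell out all p positions; a letter determines both its position and
  -- its bit, so a word can only recur at the same positions of another snapshot.
  module Snapshots {σ} (p : ℕ) (1≤p : 1 ≤ p) (char : ℕ → Bool → Fin σ)
    (char-injective : ∀ {x y a b} → x < p → y < p → char x a ≡ char y b → x ≡ y × a ≡ b)
    where

    seg : (ℕ → Bool) → ℕ → ℕ → Str σ
    seg h o zero    = []
    seg h o (suc l) = char o (h o) ∷ seg h (suc o) l

    snapshot : (ℕ → Bool) → Str σ
    snapshot h = seg h 0 p

    text : List (ℕ → Bool) → Str σ
    text hs = concat (map snapshot hs)

    length-seg : ∀ h o l → length (seg h o l) ≡ l
    length-seg h o zero    = refl
    length-seg h o (suc l) = cong suc (length-seg h (suc o) l)

    seg-+ : ∀ h o l m → seg h o (l + m) ≡ seg h o l ++ seg h (o + l) m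
    seg-+ h o zero    m = cong (λ o → seg h o m) (sym (+-identityʳ o))
    seg-+ h o (suc l) m = cong (char o (h o) ∷_)
      (trans (seg-+ h (suc o) l m) (cong (λ q → seg h (suc o) l ++ seg h q m) (sym (+-suc o l))))

    seg-cong : ∀ {g h} o l → (∀ x → o ≤ x → x < o + l → g x ≡ h x) → seg g o l ≡ seg h o l
    seg-cong o zero    e = refl
    seg-cong o (suc l) e = cong₂ _∷_ (cong (char o) (e o ≤-refl (m<m+n o (s≤s z≤n))))
      (seg-cong (suc o) l λ x o<x x< → e x (<⇒≤ o<x) (subst (x <_) (sym (+-suc o l)) x<))

    drop-seg : ∀ h o d l → drop d (seg h o (d + l)) ≡ seg h (o + d) l
    drop-seg h o d l = begin
      drop d (seg h o (d + l))                            ≡⟨ cong (drop d) (seg-+ h o d l) ⟩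
      drop d (seg h o d ++ seg h (o + d) l)               ≡⟨ cong (λ n → drop n (seg h o d ++ seg h (o + d) l)) (length-seg h o d) ⟨
      drop (length (seg h o d)) (seg h o d ++ seg h (o + d) l) ≡⟨ drop-++-exact (seg h o d) _ ⟩
      seg h (o + d) l                                     ∎
      where open ≡-Reasoning

    length-text : ∀ hs → length (text hs) ≡ length hs * p
    length-text []       = refl
    length-text (h ∷ hs) = trans (length-++ (snapshot h)) (cong₂ _+_ (length-seg h 0 p) (length-text hs))

    text-++ : ∀ gs hs → text (gs ++ hs) ≡ text gs ++ text hs
    text-++ gs hs = trans (cong concat (map-++ snapshot gs hs)) (sym (concat-++ (map snapshot gs) (map snapshot hs)))

    drop-snapshot : ∀ h j l R → j + l ≡ p → drop j (snapshot h ++ R) ≡ seg h j l ++ R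
    drop-snapshot h j l R refl = begin
      drop j (seg h 0 (j + l) ++ R)            ≡⟨ cong (λ u → drop j (u ++ R)) (seg-+ h 0 j l) ⟩
      drop j ((seg h 0 j ++ seg h j l) ++ R)   ≡⟨ cong (drop j) (++-assoc (seg h 0 j) _ R) ⟩
      drop j (seg h 0 j ++ seg h j l ++ R)     ≡⟨ cong (λ n → drop n (seg h 0 j ++ seg h j l ++ R)) (length-seg h 0 j) ⟨
      drop (length (seg h 0 j)) (seg h 0 j ++ seg h j l ++ R) ≡⟨ drop-++-exact (seg h 0 j) _ ⟩
      seg h j l ++ R                           ∎
      where open ≡-Reasoning

    drop-snapshots : ∀ gs d X → drop (length gs * p + d) (text gs ++ X) ≡ drop d X
    drop-snapshots gs d X =
      subst (λ n → drop (n + d) (text gs ++ X) ≡ drop d X) (length-text gs) (drop-length-++ (text gs) d X)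

    prefix-agree : ∀ {g h R} o l m → l ≤ m → o + m ≤ p → Prefix _≡_ (seg h o l) (seg g o m ++ R) →
                   ∀ x → o ≤ x → x < o + l → g x ≡ h x
    prefix-agree o zero    m       _       _   _       x o≤x x< =
      contradiction (≤-trans x< (≤-trans (≤-reflexive (+-identityʳ o)) o≤x)) (<-irrefl refl)
    prefix-agree {g} {h} o (suc l) (suc m) (s≤s l≤m) fit (e ∷ q) x o≤x x<
      with m≤n⇒m<n∨m≡n o≤x
    ... | inj₂ refl = sym (proj₂ (char-injective o<p o<p e))
      where o<p = ≤-trans (m<m+n o (s≤s z≤n)) fit
    ... | inj₁ o<x  = prefix-agree (suc o) l m l≤m (subst (_≤ p) (+-suc o m) fit) q x o<x (subst (x <_) (+-suc o l) x<)

    same-offset : ∀ {g h j o l m R} → o < p → j < p → 1 ≤ l →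
                  Prefix _≡_ (seg h o l) (seg g j (suc m) ++ R) → j ≡ o
    same-offset o<p j<p (s≤s _) (e ∷ _) = sym (proj₁ (char-injective o<p j<p e))

    -- The snapshot in which a copy starts is located by peeling off `before`. The first letter
    -- forces the copy to start at offset `o` there, and `o + l ≤ p` keeps it inside. In an older
    -- `g` it would then agree with `h` on the window, against the hit; in `h` itself it would not
    -- be earlier.
    no-earlier-copy : ∀ before h R {o l} → 1 ≤ l → o + l ≤ p →
                      All (λ g → Hits (λ x → g x ≢ h x) o l) before →
                      ¬ OccursBefore (text before ++ snapshot h ++ R) (length before * p + o) (seg h o l)
    no-earlier-copy [] h R {o} {l} 1≤l fit _ (j , j<o , q)
      with m , eq ← m≤n⇒∃[o]m+o≡n (≤-trans j<o (≤-trans (m≤m+n o l) fit)) =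
      <-irrefl (same-offset {h} {h} {m = m} {R} o<p (≤-trans j<o (<⇒≤ o<p)) 1≤l
        (subst (Prefix _≡_ _) (drop-snapshot h j (suc m) R (trans (+-suc j m) eq)) q)) j<o
      where
      o<p : o < p
      o<p = ≤-trans (m<m+n o 1≤l) fit
    no-earlier-copy (g ∷ gs) h R {o} {l} 1≤l fit ((x , o≤x , x< , g≢h) ∷ ds) (j , j< , q)
      with j <? p
    ... | no j≮p with i , refl ← m≤n⇒∃[o]m+o≡n (≮⇒≥ j≮p) =
      no-earlier-copy gs h R 1≤l fit ds
        (i , +-cancelˡ-< p _ _ (subst (p + i <_) (+-assoc p (length gs * p) o) j<) ,
         subst (Prefix _≡_ _) skip q)
      where
      Y = text gs ++ snapshot h ++ R
      skip : drop (p + i) ((snapshot g ++ text gs) ++ snapshot h ++ R) ≡ drop i Y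
      skip = trans (cong (drop (p + i)) (++-assoc (snapshot g) (text gs) _))
        (subst (λ n → drop (n + i) (snapshot g ++ Y) ≡ drop i Y) (length-seg g 0 p) (drop-length-++ (snapshot g) i Y))
    ... | yes j<p with m , eq ← m≤n⇒∃[o]m+o≡n j<p =
      g≢h (conflict (same-offset {g} {h} {m = m} {Z} (≤-trans (m<m+n o 1≤l) fit) j<p 1≤l q′) q′)
      where
      Z = text gs ++ snapshot h ++ R
      eq′ = trans (+-suc j m) eq
      q′ : Prefix _≡_ (seg h o l) (seg g j (suc m) ++ Z)
      q′ = subst (Prefix _≡_ _) (trans (cong (drop j) (++-assoc (snapshot g) (text gs) _)) (drop-snapshot g j (suc m) Z eq′)) q
      conflict : j ≡ o → Prefix _≡_ (seg h o l) (seg g j (suc m) ++ Z) → g x ≡ h x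
      conflict refl q = prefix-agree j l (suc m)
        (+-cancelˡ-≤ j _ _ (≤-trans fit (≤-reflexive (sym eq′)))) (≤-reflexive eq′) q x o≤x x<

    -- Novel windows in a sequence of shots.

    windowsFrom : Shot → (first count : ℕ) → List (Str σ)
    windowsFrom s m zero    = []
    windowsFrom s m (suc c) = seg (bits s) (m * size s) (size s) ∷ windowsFrom s (suc m) c

    windows : List Shot → List (Str σ)
    windows []       = []
    windows (s ∷ ss) = windowsFrom s 0 (blocks s) ++ windows ss

    length-windowsFrom : ∀ s m c → length (windowsFrom s m c) ≡ c
    length-windowsFrom s m zero    = refl
    length-windowsFrom s m (suc c) = cong suc (length-windowsFrom s (suc m) c)

    length-windows : ∀ ss → length (windows ss) ≡ totalBlocks ss
    length-windows []       = refl
    length-windows (s ∷ ss) = trans (length-++ (windowsFrom s 0 (blocks s)))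
      (cong₂ _+_ (length-windowsFrom s 0 (blocks s)) (length-windows ss))

    -- `Gs` is the continuation, novel from the end of the current snapshot. The windows tile the
    -- snapshot exactly, so the last of them stops where `Gs` begins.
    novel-windowsFrom : ∀ before s R → Fits p s → All (λ g → Fresh g s) before → ∀ {Gs} m c →
      m + c ≡ blocks s →
      NovelFrom (text before ++ snapshot (bits s) ++ R) (length before * p + p) Gs →
      NovelFrom (text before ++ snapshot (bits s) ++ R) (length before * p + m * size s) (windowsFrom s m c ++ Gs)
    novel-windowsFrom before s R (_ , fit) _ {Gs} m zero e gs =
      subst (λ n → NovelFrom (text before ++ snapshot (bits s) ++ R) (length before * p + n) Gs)
        (sym (trans (cong (_* size s) (trans (sym (+-identityʳ m)) e)) fit)) gs
    novel-windowsFrom before s R (2≤l , fit) fr {Gs} m (suc c) e gs =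
      (subst (2 ≤_) (sym len) 2≤l , here-window , no-earlier-copy before h R (<⇒≤ 2≤l) inside (All.map (λ f → f m) fr)) ,
      subst (λ n → NovelFrom (text before ++ snapshot h ++ R) n (windowsFrom s (suc m) c ++ Gs)) next
        (novel-windowsFrom before s R (2≤l , fit) fr (suc m) c (trans (sym (+-suc m c)) e) gs)
      where
      h = bits s
      l = size s
      o = m * l
      len : length (seg h o l) ≡ l
      len = length-seg h o l
      split : o + (l + c * l) ≡ p
      split = trans (sym (*-distribʳ-+ l m (suc c))) (trans (cong (_* l) e) fit)
      inside : o + l ≤ p
      inside = ≤-trans (+-monoʳ-≤ o (m≤m+n l (c * l))) (≤-reflexive split)
      here-window : Prefix _≡_ (seg h o l) (drop (length before * p + o) (text before ++ snapshot h ++ R))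
      here-window = subst (Prefix _≡_ _)
        (sym (trans (drop-snapshots before o _) (drop-snapshot h o (l + c * l) R split)))
        (subst (λ u → Prefix _≡_ (seg h o l) (u ++ R)) (sym (seg-+ h o l (c * l))) (prefix-++ _ _ ++ᵖ R))
      next : length before * p + (l + o) ≡ length before * p + o + length (seg h o l)
      next = trans (cong (length before * p +_) (trans (+-comm l o) (cong (o +_) (sym len))))
        (sym (+-assoc (length before * p) o _))

    novel-windows : ∀ before ss → All (Fits p) ss → All (λ s → All (λ g → Fresh g s) before) ss →
                    AllPairs (λ s t → Fresh (bits s) t) ss →
                    NovelFrom (text before ++ text (map bits ss)) (length before * p) (windows ss)
    novel-windows before [] _ _ _ = tt
    novel-windows before (s ∷ ss) (fit ∷ fits) (fr ∷ frs) (new ∷ news) =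
      subst (λ n → NovelFrom (text before ++ text (map bits (s ∷ ss))) n (windows (s ∷ ss))) (+-identityʳ _)
        (novel-windowsFrom before s (text (map bits ss)) fit fr 0 (blocks s) refl
          (subst₂ (λ T n → NovelFrom T n (windows ss)) same-text same-length
            (novel-windows (before ++ [ bits s ]) ss fits
              -- The current snapshot joins `before`, and its pairwise freshness against the later
              -- shots becomes part of their hypothesis.
              (All.zipWith (λ { (a , b) → All.++⁺ a (b ∷ []) }) (frs , new)) news)))
      where
      same-text : text (before ++ [ bits s ]) ++ text (map bits ss) ≡
                  text before ++ snapshot (bits s) ++ text (map bits ss)
      same-text = trans (cong (_++ text (map bits ss)) (text-++ before [ bits s ]))
        (trans (++-assoc (text before) _ _) (cong (λ u → text before ++ u ++ text (map bits ss)) (++-identityʳ _)))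
      same-length : length (before ++ [ bits s ]) * p ≡ length before * p + p
      same-length = trans (cong (_* p) (trans (length-++ before) (+-comm (length before) 1))) (+-comm p _)

    -- Cheap parsings of snapshot sequences.

    Contains : Str σ → Str σ → Set
    Contains U G = OccursBefore U (length U) G

    contains-++ : ∀ R → Contains U G → Contains (U ++ R) G
    contains-++ {U} R o with j , j< , q ← occursBefore-extend R o =
      j , ≤-trans j< (subst (length U ≤_) (sym (length-++ U)) (m≤m+n (length U) (length R))) , q

    contains-suffix : ∀ U G → 1 ≤ length G → Contains (U ++ G) G
    contains-suffix U G 1≤G = length U ,
      subst (length U <_) (sym (length-++ U)) (m<m+n (length U) 1≤G) ,
      subst (Prefix _≡_ G) (sym (drop-++-exact U G)) (subst (Prefix _≡_ G) (++-identityʳ G) (prefix-++ G []))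

    -- Shifting bounds the new start only by `length U + d`; a nonempty word cannot start at or past
    -- the end of `U`, which restores the sharp bound. An empty word keeps the old start.
    contains-inside : ∀ d → Contains U F → Prefix _≡_ G (drop d F) → Contains U G
    contains-inside {G = []} d (j , j< , _) _ = j , j< , []
    contains-inside {U = U} {G = x ∷ G} d o p with i , _ , q ← occursBefore-inside d o p =
      i , ≰⇒> (λ h → empty h q) , q
      where
      empty : ∀ {i} → length U ≤ i → ¬ Prefix _≡_ (x ∷ G) (drop i U)
      empty {i} h q with drop i U | length≤⇒drop≡[] i U h
      empty h () | _ | refl

    paste-contained : Parse U m → Contains U G → Parse (U ++ G) (suc m)
    paste-contained {G = G} ps o = paste ps G (occursBefore-extend G o)

    snapshot-length : ∀ h → 1 ≤ length (snapshot h)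
    snapshot-length h = subst (1 ≤_) (sym (length-seg h 0 p)) 1≤p

    spell : ∀ h o l → Parse U m → Parse (U ++ seg h o l) (m + l)
    spell h o zero    ps = subst₂ Parse (sym (++-identityʳ _)) (sym (+-identityʳ _)) ps
    spell {U} {m} h o (suc l) ps = subst₂ Parse (++-assoc U _ _) (sym (+-suc m l))
      (spell h (suc o) l (letter ps (char o (h o))))

    -- Three pieces: the parts left and right of position `x` are copied from the snapshot of `f`,
    -- and the letter at `x` is written afresh.
    parse-oneOff : ∀ {f g} → OneOff p f g → Parse U m → Contains U (snapshot f) →
                   Parse (U ++ snapshot g) (3 + m)
    parse-oneOff {U} {f = f} {g} (x , x<p , same) ps o
      with r , refl ← m≤n⇒∃[o]m+o≡n x<p =
      subst (λ V → Parse V _) whole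
        (paste-contained
          (letter (paste-contained ps left) (char x (g x)))
          (contains-++ _ (contains-++ _ right)))
      where
      cut : ∀ h → snapshot h ≡ seg h 0 x ++ char x (h x) ∷ seg h (suc x) r
      cut h = trans (cong (seg h 0) (sym (+-suc x r))) (seg-+ h 0 x (suc r))
      left : Contains U (seg g 0 x)
      left = contains-inside 0 o (subst₂ (Prefix _≡_)
        (seg-cong 0 x λ y _ y<x → same y (≤-trans y<x (≤-trans (n≤1+n x) (m≤m+n (suc x) r))) (<⇒≢ y<x)) (sym (cut f)) (prefix-++ _ _))
      right : Contains U (seg g (suc x) r)
      right = contains-inside (suc x) o (subst₂ (Prefix _≡_)
        (seg-cong (suc x) r λ y x<y y< → same y y< (λ { refl → <-irrefl refl x<y }))
        (sym (drop-seg f 0 (suc x) r)) (subst (Prefix _≡_ _) (++-identityʳ _) (prefix-++ _ [])))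
      whole : ((U ++ seg g 0 x) ++ [ char x (g x) ]) ++ seg g (suc x) r ≡ U ++ snapshot g
      whole = trans (++-assoc (U ++ seg g 0 x) _ _) (trans (++-assoc U _ _) (cong (U ++_) (sym (cut g))))

    parse-path : ∀ {f g hs} → Path p f g hs → Parse U m → Contains U (snapshot f) →
                 Parse (U ++ text hs) (length hs * 3 + m)
    parse-path (stop _) ps o = subst (λ V → Parse V _) (sym (++-identityʳ _)) ps
    parse-path {U} {m} (step {h = h} {hs} d π) ps o =
      subst₂ Parse (++-assoc U _ _) (trans (sym (+-assoc (length hs * 3) 3 m)) (cong (_+ m) (+-comm (length hs * 3) 3)))
        (parse-path π (parse-oneOff d ps o) (contains-suffix U _ (snapshot-length h)))

    parse-copies : ∀ gs → All (Contains U ∘ snapshot) gs → Parse U m → Parse (U ++ text gs) (length gs + m)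
    parse-copies [] _ ps = subst (λ V → Parse V _) (sym (++-identityʳ _)) ps
    parse-copies {U} {m} (g ∷ gs) (o ∷ os) ps = subst₂ Parse (++-assoc U _ _) (+-suc (length gs) m)
      (parse-copies gs (All.map (contains-++ _) os) (paste-contained ps o))

    contains-visited : ∀ {g} V hs → Any (g ≗_) hs → Contains (V ++ text hs) (snapshot g)
    contains-visited {g} V (h ∷ hs) (here e) = subst (λ W → Contains W (snapshot g)) (++-assoc V _ _)
      (contains-++ (text hs) (subst (λ u → Contains (V ++ snapshot h) u) (seg-cong 0 p λ x _ _ → sym (e x))
        (contains-suffix V (snapshot h) (snapshot-length h))))
    contains-visited V (h ∷ hs) (there v) =
      subst (λ W → Contains W _) (++-assoc V _ _) (contains-visited (V ++ snapshot h) hs v)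

    -- The two strings, their phrase counts and their length.

    module _ (k : ℕ) (filler : Fin σ) (r : ℕ) where

      -- `padding` is a run of `suc r` equal letters, bracketed as one letter and a self-overlapping
      -- copy: it adjusts the length at the cost of two pieces.
      padding source target : Str σ
      padding = ([] ++ [ filler ]) ++ replicate r filler
      source  = (padding ++ snapshot zeros) ++ text (tour k)
      target  = text (map bits (bisection k))

      parse-padding : Parse padding 2
      parse-padding = paste (letter start filler) (replicate r filler) (0 , s≤s z≤n , run r)
        where
        run : ∀ r → Prefix _≡_ (replicate r filler) (filler ∷ replicate r filler)
        run zero    = []
        run (suc r) = refl ∷ run r

      target≤z : p ≡ 2 ^ k → totalBlocks (bisection k) ≤ z target
      target≤z refl = subst (_≤ z target) (length-windows (bisection k))
        (novel≤z {Gs = windows (bisection k)} (novel-windows [] (bisection k) (bisection-fits k) (All.universal (λ _ → []) _) (bisection-fresh k)))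

      z≤source-target : p ≡ 2 ^ k →
        z (source ++ target) ≤ length (map bits (bisection k)) + (length (tour k) * 3 + (2 + p))
      z≤source-target refl = z≤pieces (parse-copies (map bits (bisection k))
        (All.map⁺ (All.map (λ {s} → contains-visited (padding ++ snapshot zeros) (tour k)) (bisection-visited k)))
        (parse-path (tour-path k) (spell zeros 0 p parse-padding)
          (contains-suffix padding _ (snapshot-length zeros))))

      -- The tour has p * p letters; the initial snapshot together with the p - 1 snapshots of
      -- `target` gives another p * p.
      length-source-target : p ≡ 2 ^ k → length (source ++ target) ≡ suc r + 2 * (2 ^ k * 2 ^ k)
      length-source-target refl = begin
        length (source ++ target)
          ≡⟨ length-++ source ⟩
        length source + length target
          ≡⟨ cong₂ _+_ (length-++ (padding ++ snapshot zeros)) (length-text (map bits (bisection k))) ⟩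
        length (padding ++ snapshot zeros) + length (text (tour k)) + length (map bits (bisection k)) * p
          ≡⟨ cong₂ (λ i j → i + j + length (map bits (bisection k)) * p)
               (trans (length-++ padding) (cong₂ _+_ (cong suc (length-replicate r)) (length-seg zeros 0 p)))
               (trans (length-text (tour k)) (cong (_* p) (length-tour k))) ⟩
        suc r + p + p * p + length (map bits (bisection k)) * p
          ≡⟨ cong (λ t → suc r + p + p * p + t * p) (length-map bits (bisection k)) ⟩
        suc r + p + p * p + t * p
          ≡⟨ solve 4 (λ r p q b → con 1 :+ r :+ p :+ q :+ b := con 1 :+ r :+ (q :+ (p :+ b))) refl r p (p * p) (t * p) ⟩
        suc r + (p * p + suc t * p)
          ≡⟨ cong (λ q → suc r + (p * p + q * p)) (length-bisection k) ⟩
        suc r + (p * p + p * p)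
          ≡⟨ cong (λ q → suc r + (p * p + q)) (+-identityʳ (p * p)) ⟨
        suc r + 2 * (p * p) ∎
        where
        open ≡-Reasoning
        open +-*-Solver
        t = length (bisection k)

  -- The alphabet.

  -- This is 2 * x + b, in a recursive form that suits the injectivity proof.
  code : ℕ → Bool → ℕ
  code zero    false = 0
  code zero    true  = 1
  code (suc x) b     = suc (suc (code x b))

  code-injective : ∀ x y {a b} → code x a ≡ code y b → x ≡ y × a ≡ b
  code-injective zero    zero    {false} {false} _ = refl , refl
  code-injective zero    zero    {true}  {true}  _ = refl , refl
  code-injective zero    (suc y) {false} ()
  code-injective zero    (suc y) {true}  ()
  code-injective (suc x) zero    {b = false} ()
  code-injective (suc x) zero    {b = true}  ()
  code-injective (suc x) (suc y) e with refl , e′ ← code-injective x y (suc-injective (suc-injective e)) = refl , e′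

  code-< : ∀ {x p} b → x < p → code x b < 2 * p
  code-< {x} {p} b x<p = ≤-trans (s≤s (bound x b)) (subst (_≤ 2 * p) (*-suc 2 x) (*-monoʳ-≤ 2 x<p))
    where
    bound : ∀ x b → code x b ≤ suc (2 * x)
    bound zero    false = z≤n
    bound zero    true  = ≤-refl
    bound (suc x) b     = subst (code (suc x) b ≤_) (cong suc (sym (*-suc 2 x))) (s≤s (s≤s (bound x b)))

  module _ (p : ℕ) .{{_ : NonZero (2 * p)}} where

    char : ℕ → Bool → Fin (2 * p)
    -- For `x < p` the code is below `2 * p`, so the reduction changes nothing.
    char x b = code x b mod (2 * p)

    char-injective : ∀ {x y a b} → x < p → y < p → char x a ≡ char y b → x ≡ y × a ≡ b
    char-injective {x} {y} {a} {b} x<p y<p e = code-injective x y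
      (trans (sym (toℕ-char a x<p)) (trans (cong toℕ e) (toℕ-char b y<p)))
      where
      toℕ-char : ∀ {x} b → x < p → toℕ (char x b) ≡ code x b
      toℕ-char {x} b x<p = trans (toℕ-fromℕ< (m%n<n (code x b) (2 * p))) (m<n⇒m%n≡m (code-< b x<p))

  -- Choice of k and the constants.

  area : ℕ → ℕ
  area k = 2 * (2 ^ k * 2 ^ k)

  area-suc : ∀ k → area (suc k) ≡ 2 ^ (3 + (k + k))
  area-suc k = cong (2 *_) (begin
    2 ^ suc k * 2 ^ suc k    ≡⟨ ^-distribˡ-+-* 2 (suc k) (suc k) ⟨
    2 ^ (suc k + suc k)      ≡⟨ cong (λ e → 2 ^ suc e) (+-suc k k) ⟩
    2 ^ (2 + (k + k))        ∎)
    where open ≡-Reasoning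

  -- The bound `area k < 9 + d` is strict because the padding has at least one letter. The threshold
  -- 9 is `area 1 + 1`, the least length that allows `1 ≤ k`.
  scale : ∀ d → ∃ λ k → 1 ≤ k × area k < 9 + d × 9 + d ≤ area (suc k)
  scale zero = 1 , ≤-refl , ≤-refl , toWitness {a? = 9 ≤? 32} tt
  scale (suc d) with k , 1≤k , lo , hi ← scale d with 10 + d ≤? area (suc k)
  ... | yes le = k , 1≤k , m≤n⇒m≤1+n lo , le
  ... | no ¬le = suc k , s≤s z≤n , ≰⇒> ¬le , ≤-trans (s≤s hi) grow
    where
    grow : area (suc k) < area (suc (suc k))
    grow = subst₂ _<_ (sym (area-suc k)) (sym (area-suc (suc k)))
      (^-monoʳ-< 2 (s≤s (s≤s z≤n)) (+-monoʳ-< 3 (+-mono-< (n<1+n k) (n<1+n k))))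

  log-scale : ∀ {k n} → 1 ≤ k → n ≤ area (suc k) → ⌈log₂ n ⌉ ≤ 5 * k
  log-scale {k} {n} 1≤k h = begin
    ⌈log₂ n ⌉                      ≤⟨ ⌈log₂⌉-mono-≤ (≤-trans h (≤-reflexive (area-suc k))) ⟩
    ⌈log₂ 2 ^ (3 + (k + k)) ⌉      ≡⟨ ⌈log₂2^n⌉≡n (3 + (k + k)) ⟩
    3 + (k + k)                    ≤⟨ +-monoˡ-≤ (k + k) (*-monoʳ-≤ 3 1≤k) ⟩
    3 * k + (k + k)                ≡⟨ solve 1 (λ k → con 3 :* k :+ (k :+ k) := con 5 :* k) refl k ⟩
    5 * k                          ∎
    where
    open ≤-Reasoning
    open +-*-Solver

  -- With p = 2 ^ k, the pieces of ST number (p - 1) + 3 * p + 2 + p, at most 6 * p, and the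
  -- logarithm is at most 5 * k. The product 30 * k * p is 60 times the number k * p / 2 of novel
  -- windows in T.
  construction : ∀ n → 9 ≤ n → ∃ λ σ → Σ (Str σ) λ S → Σ (Str σ) λ T →
                 length (S ++ T) ≡ n × ⌈log₂ n ⌉ * z (S ++ T) ≤ 60 * z T
  construction n 9≤n
    with d , refl ← m≤n⇒∃[o]m+o≡n 9≤n
    with k , 1≤k , lo , hi ← scale d
    with r , eq ← m≤n⇒∃[o]m+o≡n lo =
    2 * p , source k (char p 0 false) r , target k (char p 0 false) r ,
    trans (length-source-target k (char p 0 false) r refl) (trans (+-comm (suc r) (area k)) (trans (+-suc (area k) r) eq)) ,
    (begin
      ⌈log₂ 9 + d ⌉ * z (source k (char p 0 false) r ++ target k (char p 0 false) r)
        ≤⟨ *-mono-≤ (log-scale 1≤k hi) (≤-trans (z≤source-target k (char p 0 false) r refl) pieces) ⟩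
      5 * k * (6 * p)
        ≡⟨ solve 2 (λ k p → con 5 :* k :* (con 6 :* p) := con 30 :* (k :* p)) refl k p ⟩
      30 * (k * p)
        ≡⟨ cong (30 *_) (totalBlocks-bisection k) ⟨
      30 * (2 * totalBlocks (bisection k))
        ≡⟨ *-assoc 30 2 (totalBlocks (bisection k)) ⟨
      60 * totalBlocks (bisection k)
        ≤⟨ *-monoʳ-≤ 60 (target≤z k (char p 0 false) r refl) ⟩
      60 * z (target k (char p 0 false) r) ∎)
    where
    open ≤-Reasoning
    open +-*-Solver
    p : ℕ
    p = 2 ^ k
    instance
      2p≢0 : NonZero (2 * p)
      2p≢0 = m^n≢0 2 (suc k)
    open Snapshots p (m^n>0 2 k) (char p) (char-injective p)
    pieces : length (map bits (bisection k)) + (length (tour k) * 3 + (2 + p)) ≤ 6 * p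
    pieces = begin
      length (map bits (bisection k)) + (length (tour k) * 3 + (2 + p))
        ≡⟨ cong₂ (λ i j → i + (j * 3 + (2 + p))) (length-map bits (bisection k)) (length-tour k) ⟩
      t + (p * 3 + (2 + p))
        ≡⟨ solve 2 (λ b p → b :+ (p :* con 3 :+ (con 2 :+ p)) := con 1 :+ b :+ (con 1 :+ con 4 :* p)) refl t p ⟩
      suc t + (1 + 4 * p)
        ≡⟨ cong (_+ (1 + 4 * p)) (length-bisection k) ⟩
      p + (1 + 4 * p)
        ≤⟨ +-monoʳ-≤ p (+-monoˡ-≤ (4 * p) (m^n>0 2 k)) ⟩
      p + (p + 4 * p)
        ∎
      where t = length (bisection k)

open import Data.List.Base using (length; _++_)
open import Data.Nat.Base using (ℕ; _≥_)
open import Data.Nat.Logarithm using (⌈log₂_⌉)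
open import Data.Product.Base using (Σ; _×_; _,_)
open import Data.Rational.Base using (ℚ; 0ℚ; _<_; _≤_; _*_)
open import Relation.Binary.PropositionalEquality using (_≡_)

-- From natural numbers to rationals.

module Ratio where

  open import Data.Integer.Base as ℤ using (+_; +≤+)
  open import Data.Integer.Properties as ℤ using (pos-*)
  open import Data.Nat.Base as ℕ using ()
  open import Data.Nat.Properties as ℕ using ()
  open import Data.Rational.Base using (_/_; toℚᵘ)
  open import Data.Rational.Properties using (toℚᵘ-cancel-≤; toℚᵘ-homo-*; toℚᵘ-fromℚᵘ)
  open import Data.Rational.Unnormalised.Base as ℚᵘ using (ℚᵘ; mkℚᵘ; _≃_; *≤*)
  open import Data.Rational.Unnormalised.Properties as ℚᵘ using ()
  open import Relation.Binary.PropositionalEquality using (sym; trans; cong; subst₂)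

  sixtieth : ℚ
  sixtieth = + 1 / 60

  ℕ→ℚᵘ : ℕ → ℚᵘ
  ℕ→ℚᵘ n = mkℚᵘ (+ n) 0

  toℚᵘ-ℕ→ℚ : ∀ n → toℚᵘ (ℕ→ℚ n) ≃ ℕ→ℚᵘ n
  toℚᵘ-ℕ→ℚ n = toℚᵘ-fromℚᵘ (ℕ→ℚᵘ n)

  toℚᵘ-product : ∀ a b → toℚᵘ (sixtieth * ℕ→ℚ a * ℕ→ℚ b) ≃ mkℚᵘ (+ 1) 59 ℚᵘ.* ℕ→ℚᵘ a ℚᵘ.* ℕ→ℚᵘ b
  toℚᵘ-product a b = ℚᵘ.≃-trans (toℚᵘ-homo-* (sixtieth * ℕ→ℚ a) (ℕ→ℚ b))
    (ℚᵘ.*-cong (ℚᵘ.≃-trans (toℚᵘ-homo-* sixtieth (ℕ→ℚ a)) (ℚᵘ.*-congˡ {mkℚᵘ (+ 1) 59} (toℚᵘ-ℕ→ℚ a))) (toℚᵘ-ℕ→ℚ b))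

  -- In unnormalised rationals the product keeps its denominator 60 (stored as 59), so the
  -- inequality is the hypothesis after cross-multiplication.
  sixtieth-*-≤ : ∀ a b c → a ℕ.* b ℕ.≤ 60 ℕ.* c → sixtieth * ℕ→ℚ a * ℕ→ℚ b ≤ ℕ→ℚ c
  sixtieth-*-≤ a b c h = toℚᵘ-cancel-≤ (ℚᵘ.≤-respˡ-≃ (ℚᵘ.≃-sym (toℚᵘ-product a b))
    (ℚᵘ.≤-respʳ-≃ (ℚᵘ.≃-sym (toℚᵘ-ℕ→ℚ c)) (*≤* (subst₂ ℤ._≤_ (sym left) (trans (cong (+_) (ℕ.*-comm 60 c)) (pos-* c 60)) (+≤+ h)))))
    where
    left : (+ 1 ℤ.* + a ℤ.* + b) ℤ.* + 1 ≡ + (a ℕ.* b)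
    left = trans (ℤ.*-identityʳ _) (trans (cong (ℤ._* + b) (ℤ.*-identityˡ (+ a))) (sym (pos-* a b)))

open import Data.Rational.Properties using (positive⁻¹)
open Construction using (construction)
open Ratio using (sixtieth; sixtieth-*-≤)

theorem7 : Σ ℚ λ κ → 0ℚ < κ × (Σ ℕ λ n₀ →
    ∀ (n : ℕ) → n ≥ n₀ →
    Σ ℕ λ σ → Σ (Str σ) λ S → Σ (Str σ) λ T →
    length (S ++ T) ≡ n ×
    κ * ℕ→ℚ ⌈log₂ n ⌉ * ℕ→ℚ (z (S ++ T)) ≤ ℕ→ℚ (z T))
theorem7 = sixtieth , positive⁻¹ sixtieth , 9 , λ n n≥9 →
  let σ , S , T , size , ratio = construction n n≥9
  in σ , S , T , size , sixtieth-*-≤ ⌈log₂ n ⌉ (z (S ++ T)) (z T) ratio
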